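{- For any oriented graph $G$, $\chi^*_o(G) \geq \frac{|V(G)|}{\alpha_o(G)}$.
   Context: An oriented graph is a finite directed graph with no directed cycle of length 1 or 2. For a set $S$ of $k$ colors, a $b$-fold oriented $k$-coloring of $G$ is a map $f$ from $V(G)$ to the $b$-element subsets of $S$ such that (i) $f(x)\cap f(y)=\emptyset$ for every arc $xy$, and (ii) for all arcs $xy, zw$, $f(x)\cap f(w)\neq\emptyset$ implies $f(y)\cap f(z)=\emptyset$. $\chi^b_o(G)$ is the minimum such $k$, and $\chi^*_o(G)=\lim_{b\to\infty}\chi^b_o(G)/b=\inf_{b\ge1}\chi^b_o(G)/b$. An oriented coloring is a $1$-fold oriented coloring (viewed as a map to colors). A set $I\subseteq V(G)$ is an oriented independent set if for every two distinct $x,y\in I$ there is an oriented coloring $f$ of $G$ with $f(x)=f(y)$. The oriented independence number $\alpha_o(G)$ is the maximum size of an oriented independent set. -}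

module Defs where

open import Data.Fin.Base using (Fin; toℕ) renaming (zero to fzero; suc to fsuc)
open import Data.Fin.Properties using (all?; any?; toℕ-injective) renaming (_≟_ to _≟ᶠ_)
open import Data.Fin.Subset using (Subset; inside; outside; _∈_; _∩_; ∣_∣; ⁅_⁆; ⊤; ⊥; Nonempty; Empty)
open import Data.Fin.Subset.Properties
  using (_∈?_; anySubset?; nonempty?; x∈⁅x⁆; x∈⁅y⁆⇒x≡y; x∈p∩q⁺; x∈p∩q⁻; ∣⁅x⁆∣≡1; ∣p∣≤n;
         ∣⊤∣≡n; ∣⊥∣≡0; ∉⊥)
import Data.Integer.Base as ℤ
open import Data.Nat.Base using (ℕ; zero; suc; _+_; _*_; _≤_; NonZero; >-nonZero; s≤s⁻¹)
open import Data.Nat.Induction using (<-rec)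
open import Data.Nat.Properties
  using (anyUpTo?; ≮⇒≥; ≤-antisym; ≤∧≢⇒<; n≤0⇒n≡0; +-identityʳ; _≟_)
open import Data.Product.Base using (Σ; ∃; ∃-syntax; _×_; _,_; proj₁; proj₂)
open import Data.Rational.Base as ℚ using (ℚ; 0ℚ; _/_)
import Data.Rational.Properties as ℚ
open import Data.Vec.Base using (Vec; []; _∷_; _++_; lookup; tabulate; here; there)
open import Data.Vec.Properties using (lookup∘tabulate)
open import Function.Base using (_∘_)
open import Relation.Binary.Core using (Rel)
open import Relation.Binary.Definitions using (Irreflexive; Asymmetric)
  renaming (Decidable to Decidable₂)
open import Relation.Binary.PropositionalEquality
  using (_≡_; _≢_; refl; sym; trans; cong; cong₂; subst; subst₂; module ≡-Reasoning)
open import Relation.Nullary.Decidable using (Dec; yes; no; map′; ¬?; _×-dec_; _→-dec_)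
open import Relation.Nullary.Negation using (¬_; contradiction)
open import Relation.Unary using (Pred; Decidable)
open import Level using (0ℓ)

------------------------------------------------------------------------
-- Extrema of decidable sets of natural numbers

IsMinimum : Pred ℕ 0ℓ → Pred ℕ 0ℓ
IsMinimum P m = P m × (∀ k → P k → m ≤ k)

IsMaximum : Pred ℕ 0ℓ → Pred ℕ 0ℓ
IsMaximum P m = P m × (∀ k → P k → k ≤ m)

minimum : {P : Pred ℕ 0ℓ} → Decidable P → ∃ P → ∃ (IsMinimum P)
minimum {P} P? (m , Pm) = <-rec (λ m → P m → ∃ (IsMinimum P)) step m Pm
  where
  step : ∀ m → (∀ {k} → suc k ≤ m → P k → ∃ (IsMinimum P)) → P m → ∃ (IsMinimum P)
  step m rec Pm with anyUpTo? P? m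
  ... | yes (k , k<m , Pk) = rec k<m Pk
  ... | no  none           = m , Pm , λ k Pk → ≮⇒≥ (λ k<m → none (k , k<m , Pk))

maximum : {P : Pred ℕ 0ℓ} → Decidable P → ∃ P →
          ∀ n → (∀ k → P k → k ≤ n) → ∃ (IsMaximum P)
maximum P? P∃ n bound with P? n
... | yes Pn = n , Pn , bound
maximum {P} P? (m , Pm) zero bound | no ¬Pn =
  contradiction (subst P (n≤0⇒n≡0 (bound m Pm)) Pm) ¬Pn
maximum {P} P? P∃ (suc n) bound | no ¬Pn =
  maximum P? P∃ n λ k Pk → s≤s⁻¹ (≤∧≢⇒< (bound k Pk) (λ k≡n → ¬Pn (subst P k≡n Pk)))

------------------------------------------------------------------------
-- Oriented graphs

record OrientedGraph : Set₁ where
  field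
    order      : ℕ
    Arc        : Rel (Fin order) 0ℓ
    Arc?       : Decidable₂ Arc
    no-loop    : Irreflexive _≡_ Arc
    no-2-cycle : Asymmetric Arc

  Vertex : Set
  Vertex = Fin order

open OrientedGraph public using (order; Vertex)

module _ (G : OrientedGraph) where
  open OrientedGraph G hiding (order; Vertex)

  private
    V = Vertex G

  record IsFoldColoring (b k : ℕ) (f : V → Subset k) : Set where
    field
      size     : ∀ x → ∣ f x ∣ ≡ b
      proper   : ∀ {x y} → Arc x y → Empty (f x ∩ f y)
      oriented : ∀ {x y z w} → Arc x y → Arc z w →
                 Nonempty (f x ∩ f w) → Empty (f y ∩ f z)

  FoldColorable : ℕ → ℕ → Set
  FoldColorable b k = ∃[ f ] IsFoldColoring b k f

  IsOrientedColoring : (k : ℕ) → (V → Fin k) → Set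
  IsOrientedColoring k c = IsFoldColoring 1 k (λ x → ⁅ c x ⁆)

  Identifiable : V → V → Set
  Identifiable x y = ∃[ k ] Σ (V → Fin k) λ c → IsOrientedColoring k c × c x ≡ c y

  IsOrientedIndependent : Subset (order G) → Set
  IsOrientedIndependent I = ∀ x y → x ∈ I → y ∈ I → x ≢ y → Identifiable x y

  HasIndependentSetOfSize : ℕ → Set
  HasIndependentSetOfSize m = ∃[ I ] IsOrientedIndependent I × ∣ I ∣ ≡ m

------------------------------------------------------------------------
-- The minimum and maximum defining χᵇₒ and αₒ exist

private
  anyVec? : {A : Set} → (∀ {P : Pred A 0ℓ} → Decidable P → Dec (∃ P)) →
            ∀ n {P : Pred (Vec A n) 0ℓ} → Decidable P → Dec (∃ P)
  anyVec? anyA? zero    P? = map′ (λ p → [] , p) (λ { ([] , p) → p }) (P? [])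
  anyVec? anyA? (suc n) P? =
    map′ (λ (a , v , p) → a ∷ v , p) (λ { (a ∷ v , p) → a , v , p })
      (anyA? λ a → anyVec? anyA? n λ v → P? (a ∷ v))

  anyFunction? : {A : Set} → (∀ {P : Pred A 0ℓ} → Decidable P → Dec (∃ P)) →
                 ∀ {n} {P : Pred (Fin n → A) 0ℓ} →
                 (∀ {f g} → (∀ x → f x ≡ g x) → P f → P g) →
                 Decidable P → Dec (∃ P)
  anyFunction? anyA? resp P? =
    map′ (λ (v , p) → lookup v , p)
         (λ (f , p) → tabulate f , resp (λ x → sym (lookup∘tabulate f x)) p)
         (anyVec? anyA? _ (P? ∘ lookup))

  singletons-meet : ∀ {k} {a b : Fin k} → Nonempty (⁅ a ⁆ ∩ ⁅ b ⁆) → a ≡ b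
  singletons-meet {a = a} {b} (c , c∈) with c∈a , c∈b ← x∈p∩q⁻ ⁅ a ⁆ ⁅ b ⁆ c∈ =
    trans (sym (x∈⁅y⁆⇒x≡y a c∈a)) (x∈⁅y⁆⇒x≡y b c∈b)

  meet-singletons : ∀ {k} {a b : Fin k} → a ≡ b → Nonempty (⁅ a ⁆ ∩ ⁅ b ⁆)
  meet-singletons {a = a} refl = a , x∈p∩q⁺ (x∈⁅x⁆ a , x∈⁅x⁆ a)

  -- n pairwise disjoint sets of b colors each.
  block : ∀ n b → Fin n → Subset (n * b)
  block (suc n) b fzero    = ⊤ {b} ++ ⊥ {n * b}
  block (suc n) b (fsuc x) = ⊥ {b} ++ block n b x

  ∣++∣ : ∀ {m n} (p : Subset m) (q : Subset n) → ∣ p ++ q ∣ ≡ ∣ p ∣ + ∣ q ∣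
  ∣++∣ []                q = refl
  ∣++∣ (inside  ∷ p) q = cong suc (∣++∣ p q)
  ∣++∣ (outside ∷ p) q = ∣++∣ p q

  ∣block∣ : ∀ n b x → ∣ block n b x ∣ ≡ b
  ∣block∣ (suc n) b fzero = begin
    ∣ ⊤ {b} ++ ⊥ {n * b} ∣       ≡⟨ ∣++∣ (⊤ {b}) (⊥ {n * b}) ⟩
    ∣ ⊤ {b} ∣ + ∣ ⊥ {n * b} ∣    ≡⟨ cong₂ _+_ (∣⊤∣≡n b) (∣⊥∣≡0 (n * b)) ⟩
    b + 0                        ≡⟨ +-identityʳ b ⟩
    b                            ∎
    where open ≡-Reasoning
  ∣block∣ (suc n) b (fsuc x) = begin
    ∣ ⊥ {b} ++ block n b x ∣     ≡⟨ ∣++∣ (⊥ {b}) (block n b x) ⟩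
    ∣ ⊥ {b} ∣ + ∣ block n b x ∣  ≡⟨ cong₂ _+_ (∣⊥∣≡0 b) (∣block∣ n b x) ⟩
    b                            ∎
    where open ≡-Reasoning

  ⊤⊥-disjoint : ∀ b {m} {q : Subset m} {c} → c ∈ ⊤ {b} ++ ⊥ {m} → ¬ (c ∈ ⊥ {b} ++ q)
  ⊤⊥-disjoint zero    c∈        _         = ∉⊥ c∈
  ⊤⊥-disjoint (suc b) (there c∈) (there d) = ⊤⊥-disjoint b c∈ d

  drop-⊥ : ∀ b {m} {p q : Subset m} {c} → c ∈ ⊥ {b} ++ p → c ∈ ⊥ {b} ++ q →
           ∃[ d ] (d ∈ p × d ∈ q)
  drop-⊥ zero    c∈p        c∈q         = _ , c∈p , c∈q
  drop-⊥ (suc b) (there c∈p) (there c∈q) = drop-⊥ b c∈p c∈q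

  blocks-meet : ∀ n b x y {c} → c ∈ block n b x → c ∈ block n b y → x ≡ y
  blocks-meet (suc n) b fzero    fzero    _   _   = refl
  blocks-meet (suc n) b fzero    (fsuc y) c∈x c∈y = contradiction c∈y (⊤⊥-disjoint b c∈x)
  blocks-meet (suc n) b (fsuc x) fzero    c∈x c∈y = contradiction c∈x (⊤⊥-disjoint b c∈y)
  blocks-meet (suc n) b (fsuc x) (fsuc y) c∈x c∈y
    with _ , d∈x , d∈y ← drop-⊥ b c∈x c∈y = cong fsuc (blocks-meet n b x y d∈x d∈y)

module _ (G : OrientedGraph) where
  open OrientedGraph G hiding (order; Vertex)

  private
    V = Vertex G

    isFoldColoring? : ∀ b k → Decidable (IsFoldColoring G b k)
    isFoldColoring? b k f =
      map′ (λ (s , p , o) → record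
             { size     = s
             ; proper   = λ {x} {y} → p x y
             ; oriented = λ {x} {y} {z} {w} → o x y z w })
           (λ c → let open IsFoldColoring c in
             size , (λ _ _ → proper) , (λ _ _ _ _ → oriented))
           (all? (λ x → ∣ f x ∣ ≟ b)
            ×-dec all? (λ x → all? λ y → Arc? x y →-dec ¬? (nonempty? (f x ∩ f y)))
            ×-dec all? (λ x → all? λ y → all? λ z → all? λ w →
                    Arc? x y →-dec Arc? z w →-dec
                    nonempty? (f x ∩ f w) →-dec ¬? (nonempty? (f y ∩ f z))))

    transport : ∀ {b b′ k k′} {f : V → Subset k} {g : V → Subset k′} →
                (∀ x → ∣ g x ∣ ≡ b′) →
                (∀ x y → Nonempty (g x ∩ g y) → Nonempty (f x ∩ f y)) →
                IsFoldColoring G b k f → IsFoldColoring G b′ k′ g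
    transport s meet c = record
      { size     = s
      ; proper   = λ a → proper a ∘ meet _ _
      ; oriented = λ a a′ m → oriented a a′ (meet _ _ m) ∘ meet _ _
      }
      where open IsFoldColoring c

    resp-fold : ∀ {b k} {f g : V → Subset k} → (∀ x → f x ≡ g x) →
                IsFoldColoring G b k f → IsFoldColoring G b k g
    resp-fold f≗g c = transport
      (λ x → trans (cong ∣_∣ (sym (f≗g x))) (IsFoldColoring.size c x))
      (λ x y → subst₂ (λ p q → Nonempty (p ∩ q)) (sym (f≗g x)) (sym (f≗g y))) c

    foldColorable? : ∀ b k → Dec (FoldColorable G b k)
    foldColorable? b k = anyFunction? anySubset? resp-fold (isFoldColoring? b k)

    foldColorable : ∀ b → ∃ (FoldColorable G b)
    foldColorable b = order G * b , f , record
      { size     = ∣block∣ (order G) b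
      ; proper   = λ {x} {y} a m → no-loop (meet x y m) a
      ; oriented = λ {x} {y} {z} {w} a a′ m m′ →
          no-2-cycle a (subst₂ Arc (sym (meet y z m′)) (sym (meet x w m)) a′)
      }
      where
      f = block (order G) b
      meet : ∀ x y → Nonempty (f x ∩ f y) → x ≡ y
      meet x y (_ , c∈) with c∈x , c∈y ← x∈p∩q⁻ (f x) (f y) c∈ =
        blocks-meet (order G) b x y c∈x c∈y

    -- Colors may be replaced by the first vertex bearing them, so order G
    -- colors suffice to decide identifiability.
    IdentifiableInV : V → V → Set
    IdentifiableInV x y = Σ (V → V) λ c → IsOrientedColoring G (order G) c × c x ≡ c y

    canonical : ∀ {x y} → Identifiable G x y → IdentifiableInV x y
    canonical {x} {y} (k , c , col , cx≡cy) = r , r-col , r-cong cx≡cy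
      where
      Bearer : V → Pred ℕ 0ℓ
      Bearer v m = ∃[ u ] (toℕ u ≡ m × c u ≡ c v)
      first : ∀ v → ∃ (IsMinimum (Bearer v))
      first v = minimum (λ m → any? λ u → (toℕ u ≟ m) ×-dec (c u ≟ᶠ c v))
                        (toℕ v , v , refl , refl)
      r : V → V
      r v = proj₁ (proj₁ (proj₂ (first v)))
      cr≡c : ∀ v → c (r v) ≡ c v
      cr≡c v = proj₂ (proj₂ (proj₁ (proj₂ (first v))))
      r-least : ∀ v u → c u ≡ c v → toℕ (r v) ≤ toℕ u
      r-least v u cu≡cv
        rewrite proj₁ (proj₂ (proj₁ (proj₂ (first v)))) =
        proj₂ (proj₂ (first v)) (toℕ u) (u , refl , cu≡cv)
      r-cong : ∀ {u v} → c u ≡ c v → r u ≡ r v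
      r-cong {u} {v} e = toℕ-injective (≤-antisym
        (r-least u (r v) (trans (cr≡c v) (sym e)))
        (r-least v (r u) (trans (cr≡c u) e)))
      r-col : IsOrientedColoring G (order G) r
      r-col = transport (λ v → ∣⁅x⁆∣≡1 (r v))
        (λ u v m → meet-singletons
          (trans (sym (cr≡c u)) (trans (cong c (singletons-meet m)) (cr≡c v))))
        col

    identifiable? : ∀ x y → Dec (Identifiable G x y)
    identifiable? x y = map′ (λ p → order G , p) canonical
      (anyFunction? any?
        (λ f≗g (col , e) → resp-fold (λ v → cong ⁅_⁆ (f≗g v)) col
                         , trans (sym (f≗g x)) (trans e (f≗g y)))
        (λ c → isFoldColoring? 1 (order G) (λ v → ⁅ c v ⁆) ×-dec (c x ≟ᶠ c y)))

    hasIndependentSetOfSize? : Decidable (HasIndependentSetOfSize G)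
    hasIndependentSetOfSize? m = anySubset? λ I →
      all? (λ x → all? λ y →
        (x ∈? I) →-dec (y ∈? I) →-dec ¬? (x ≟ᶠ y) →-dec identifiable? x y)
      ×-dec (∣ I ∣ ≟ m)

    independent-⊥ : HasIndependentSetOfSize G 0
    independent-⊥ = ⊥ , (λ _ _ x∈⊥ → contradiction x∈⊥ ∉⊥) , ∣⊥∣≡0 (order G)

    independent-⁅_⁆ : V → HasIndependentSetOfSize G 1
    independent-⁅ v ⁆ = ⁅ v ⁆
      , (λ x y x∈ y∈ x≢y →
          contradiction (trans (x∈⁅y⁆⇒x≡y v x∈) (sym (x∈⁅y⁆⇒x≡y v y∈))) x≢y)
      , ∣⁅x⁆∣≡1 v

  minimumFoldColoring : ∀ b → ∃ (IsMinimum (FoldColorable G b))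
  minimumFoldColoring b = minimum (foldColorable? b) (foldColorable b)

  maximumIndependentSet : ∃ (IsMaximum (HasIndependentSetOfSize G))
  maximumIndependentSet = maximum hasIndependentSetOfSize? (0 , independent-⊥) (order G)
    λ { _ (I , _ , refl) → ∣p∣≤n I }

  χₒ : ℕ → ℕ
  χₒ b = proj₁ (minimumFoldColoring b)

  αₒ : ℕ
  αₒ = proj₁ maximumIndependentSet

  private
    αₒ-positive : ∀ n → n ≡ order G → .{{NonZero n}} → NonZero αₒ
    αₒ-positive (suc n) e =
      >-nonZero (proj₂ (proj₂ maximumIndependentSet) 1 independent-⁅ subst Fin e fzero ⁆)

  αₒ-nonZero : .{{NonZero (order G)}} → NonZero αₒ
  αₒ-nonZero = αₒ-positive (order G) refl

instance
  αₒ-nonZero-instance : ∀ {G} → .{{NonZero (order G)}} → NonZero (αₒ G)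
  αₒ-nonZero-instance {G} = αₒ-nonZero G

------------------------------------------------------------------------
-- Real numbers

-- A real x is given by its upper cut { q ∈ ℚ ∣ x < q }.  Classically these
-- are exactly the real numbers; constructively they are the upper reals,
-- which have infima of inhabited families bounded below.
record ℝ : Set₁ where
  field
    Above     : ℚ → Set
    inhabited : ∃[ q ] Above q
    bounded   : ∃[ p ] (∀ q → Above q → p ℚ.≤ q)
    upward    : ∀ {p q} → Above p → p ℚ.≤ q → Above q
    rounded   : ∀ {q} → Above q → ∃[ p ] (Above p × p ℚ.< q)

open ℝ

infix 4 _≤ʳ_ _≥ʳ_

_≤ʳ_ : ℝ → ℝ → Set
x ≤ʳ y = ∀ q → Above y q → Above x q

_≥ʳ_ : ℝ → ℝ → Set
x ≥ʳ y = y ≤ʳ x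

fromℚ : ℚ → ℝ
fromℚ r = record
  { Above     = r ℚ.<_
  ; inhabited = r ℚ.+ ℚ.1ℚ ,
                subst (ℚ._< r ℚ.+ ℚ.1ℚ) (ℚ.+-identityʳ r) (ℚ.+-monoʳ-< r (ℚ.positive⁻¹ ℚ.1ℚ))
  ; bounded   = r , λ _ → ℚ.<⇒≤
  ; upward    = ℚ.<-≤-trans
  ; rounded   = λ r<q → let p , r<p , p<q = ℚ.<-dense r<q in p , r<p , p<q
  }

IsInfimum : {I : Set} → (I → ℝ) → ℝ → Set₁
IsInfimum a x = (∀ i → x ≤ʳ a i) × (∀ z → (∀ i → z ≤ʳ a i) → z ≤ʳ x)

infimum : {I : Set} (a : I → ℚ) → I → ∃[ l ] (∀ i → l ℚ.≤ a i) →
          Σ ℝ (IsInfimum (fromℚ ∘ a))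
infimum a i₀ (l , l≤a) = x
  , (λ i q a<q → i , a<q)
  , (λ z z≤a q (i , a<q) → z≤a i q a<q)
  where
  x : ℝ
  x = record
    { Above     = λ q → ∃[ i ] a i ℚ.< q
    ; inhabited = let q , a<q = inhabited (fromℚ (a i₀)) in q , i₀ , a<q
    ; bounded   = l , λ _ (i , a<q) → ℚ.≤-trans (l≤a i) (ℚ.<⇒≤ a<q)
    ; upward    = λ (i , a<p) p≤q → i , ℚ.<-≤-trans a<p p≤q
    ; rounded   = λ (i , a<q) → let p , a<p , p<q = ℚ.<-dense a<q in p , (i , a<p) , p<q
    }

------------------------------------------------------------------------
-- The fractional oriented chromatic number

module _ (G : OrientedGraph) where

  foldRatio : Σ ℕ (λ b → NonZero b) → ℚ
  foldRatio (b , b≢0) = _/_ (ℤ.+ χₒ G b) b {{b≢0}}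

  -- The sequence χₒ G b / b converges to its infimum over b ≥ 1, and the
  -- infimum is taken as the definition.
  χₒ* : ℝ
  χₒ* = proj₁ (infimum foldRatio (1 , _)
    (0ℚ , λ (b , b≢0) →
      ℚ.nonNegative⁻¹ _ {{ℚ.normalize-nonNeg (χₒ G b) b {{b≢0}}}}))

{-# OPTIONS --safe #-}

-- The vertices receiving a fixed color c in a b-fold coloring form an oriented
-- independent set: picking one color from each f x, and c whenever possible,
-- gives an oriented coloring constant on that class. Each of the χₒ G b classes
-- thus has at most αₒ G vertices, while together they cover each vertex b times.

module Submission where

open import Defs
import Algebra.Properties.CommutativeMonoid.Sum
open import Data.Bool.Base using (if_then_else_)
open import Data.Fin.Base using (Fin; zero; suc)
open import Data.Fin.Subset using (Subset; inside; outside; _∈_; _∩_; ∣_∣; ⁅_⁆; Nonempty)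
open import Data.Fin.Subset.Properties
  using (_∈?_; nonempty?; Empty-unique; x∈⁅y⁆⇒x≡y; x∈p∩q⁺; x∈p∩q⁻; ∣⁅x⁆∣≡1; ∣⊥∣≡0)
open import Data.Integer.Base as ℤ using (+_; +≤+)
import Data.Integer.Properties as ℤ
open import Data.Nat.Base using (ℕ; zero; suc; _*_; _≤_; z≤n; NonZero; ≢-nonZero⁻¹)
open import Data.Nat.Properties
  using (≤-reflexive; +-mono-≤; +-0-commutativeMonoid; module ≤-Reasoning)
open import Data.Product.Base using (∃-syntax; _×_; _,_; proj₁; proj₂)
open import Data.Rational.Base as ℚ using (_/_; toℚᵘ)
import Data.Rational.Properties as ℚ
import Data.Rational.Unnormalised.Base as ℚᵘ
import Data.Rational.Unnormalised.Properties as ℚᵘ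
open import Data.Vec.Base using ([]; _∷_; lookup; tabulate)
open import Data.Vec.Properties using (lookup∘tabulate; []=⇒lookup; lookup⇒[]=)
open import Function.Base using (_∘_; it)
open import Relation.Binary.PropositionalEquality
  using (_≡_; refl; sym; trans; cong; subst; subst₂; module ≡-Reasoning)
open import Relation.Nullary.Decidable using (yes; no)
open import Relation.Nullary.Negation using (contradiction)

open Algebra.Properties.CommutativeMonoid.Sum +-0-commutativeMonoid using (sum; sum-cong-≗; ∑-comm)

sum-≤-* : ∀ {n m} (t : Fin n → ℕ) → (∀ i → t i ≤ m) → sum t ≤ n * m
sum-≤-* {zero}  t t≤m = z≤n
sum-≤-* {suc n} t t≤m = +-mono-≤ (t≤m zero) (sum-≤-* (t ∘ suc) (t≤m ∘ suc))

*-≤-sum : ∀ {n m} (t : Fin n → ℕ) → (∀ i → m ≤ t i) → n * m ≤ sum t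
*-≤-sum {zero}  t m≤t = z≤n
*-≤-sum {suc n} t m≤t = +-mono-≤ (m≤t zero) (*-≤-sum (t ∘ suc) (m≤t ∘ suc))

indicator : ∀ {n} → Subset n → Fin n → ℕ
indicator p i = if lookup p i then 1 else 0

∣p∣≡sum-indicator : ∀ {n} (p : Subset n) → ∣ p ∣ ≡ sum (indicator p)
∣p∣≡sum-indicator []            = refl
∣p∣≡sum-indicator (inside  ∷ p) = cong suc (∣p∣≡sum-indicator p)
∣p∣≡sum-indicator (outside ∷ p) = ∣p∣≡sum-indicator p

∣p∣≢0⇒nonempty : ∀ {n} (p : Subset n) → .{{NonZero ∣ p ∣}} → Nonempty p
∣p∣≢0⇒nonempty {n} p with nonempty? p
... | yes ne = ne
... | no  ¬ne = contradiction (trans (cong ∣_∣ (Empty-unique ¬ne)) (∣⊥∣≡0 n)) (≢-nonZero⁻¹ ∣ p ∣)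

-- The color class of `c`, encoded as a column of the incidence matrix of `f` so that double
-- counting becomes summation by columns.
fiber : ∀ {n k} → (Fin n → Subset k) → Fin k → Subset n
fiber f c = tabulate λ x → lookup (f x) c

∈-fiber⁻ : ∀ {n k} (f : Fin n → Subset k) {c x} → x ∈ fiber f c → c ∈ f x
∈-fiber⁻ f {c} {x} x∈ =
  lookup⇒[]= c (f x) (trans (sym (lookup∘tabulate _ x)) ([]=⇒lookup x∈))

-- Both sides count the pairs `(x , c)` with `c ∈ f x`: with cardinalities written as sums of
-- indicators, the two finite sums may be exchanged.
double-count : ∀ {n k} (f : Fin n → Subset k) →
               sum (λ x → ∣ f x ∣) ≡ sum (λ c → ∣ fiber f c ∣)
double-count {n} {k} f = begin
  sum (λ x → ∣ f x ∣)                            ≡⟨ sum-cong-≗ (∣p∣≡sum-indicator ∘ f) ⟩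
  sum (λ x → sum (λ c → indicator (f x) c))      ≡⟨ ∑-comm (indicator ∘ f) ⟩
  sum (λ c → sum (λ x → indicator (f x) c))      ≡⟨ sum-cong-≗ (λ c → sum-cong-≗ λ x →
      cong (if_then 1 else 0) (sym (lookup∘tabulate (λ x → lookup (f x) c) x))) ⟩
  sum (λ c → sum (indicator (fiber f c)))        ≡⟨ sum-cong-≗ (sym ∘ ∣p∣≡sum-indicator ∘ fiber f) ⟩
  sum (λ c → ∣ fiber f c ∣)                      ∎
  where open ≡-Reasoning

-- Fractions in `ℚ` are reduced to lowest terms, which hides `m` and `d`. Up to `≃` they equal the
-- unreduced fractions in `ℚᵘ`, whose order is cross multiplication.
/-mono-≤ : ∀ m d n e .{{_ : NonZero d}} .{{_ : NonZero e}} →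
           m * e ≤ n * d → + m / d ℚ.≤ + n / e
/-mono-≤ m (suc d) n (suc e) me≤nd = ℚ.toℚᵘ-cancel-≤ (begin
  toℚᵘ (+ m / suc d)  ≃⟨ ℚ.toℚᵘ-fromℚᵘ (+ m ℚᵘ./ suc d) ⟩
  + m ℚᵘ./ suc d      ≤⟨ ℚᵘ.*≤* (subst₂ ℤ._≤_ (ℤ.pos-* m (suc e)) (ℤ.pos-* n (suc d)) (+≤+ me≤nd)) ⟩
  + n ℚᵘ./ suc e      ≃⟨ ℚ.toℚᵘ-fromℚᵘ (+ n ℚᵘ./ suc e) ⟨
  toℚᵘ (+ n / suc e)  ∎)
  where
  open ℚᵘ.≤-Reasoning

module _ {G : OrientedGraph} {b k : ℕ} {f : Vertex G → Subset k}
         (col : IsFoldColoring G b k f) where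
  open IsFoldColoring col

  -- If `g x` and `g y` agree, their common value lies in both `f x` and `f y`. The coloring
  -- conditions only forbid certain sets from meeting, alone or simultaneously, so they pass from
  -- `f` to `g`.
  selection-isOrientedColoring : (g : Vertex G → Fin k) → (∀ x → g x ∈ f x) →
                                 IsOrientedColoring G k g
  selection-isOrientedColoring g g∈f = record
    { size     = λ x → ∣⁅x⁆∣≡1 (g x)
    ; proper   = λ a → proper a ∘ meet _ _
    ; oriented = λ a a′ m → oriented a a′ (meet _ _ m) ∘ meet _ _
    }
    where
    meet : ∀ x y → Nonempty (⁅ g x ⁆ ∩ ⁅ g y ⁆) → Nonempty (f x ∩ f y)
    meet x y (c , c∈) with c∈x , c∈y ← x∈p∩q⁻ ⁅ g x ⁆ ⁅ g y ⁆ c∈ = c , x∈p∩q⁺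
      ( subst (_∈ f x) (sym (x∈⁅y⁆⇒x≡y (g x) c∈x)) (g∈f x)
      , subst (_∈ f y) (sym (x∈⁅y⁆⇒x≡y (g y) c∈y)) (g∈f y) )

  fiber-independent : .{{NonZero b}} → ∀ c → IsOrientedIndependent G (fiber f c)
  fiber-independent c x y x∈ y∈ _ =
    k , g , selection-isOrientedColoring g (λ z → proj₁ (proj₂ (choose z))) ,
    trans (g≡c x x∈) (sym (g≡c y y∈))
    where
    -- The last component records that `c` is taken wherever it is available; this makes `g`
    -- constant on the fiber. Elsewhere some color exists because `b` is nonzero.
    choose : ∀ z → ∃[ d ] (d ∈ f z × (c ∈ f z → d ≡ c))
    choose z with c ∈? f z
    ... | yes c∈ = c , c∈ , λ _ → refl
    ... | no  c∉ = let d , d∈ = ∣p∣≢0⇒nonempty (f z) {{subst NonZero (sym (size z)) it}}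
                   in d , d∈ , λ c∈ → contradiction c∈ c∉

    g : Vertex G → Fin k
    g = proj₁ ∘ choose

    g≡c : ∀ z → z ∈ fiber f c → g z ≡ c
    g≡c z z∈ = proj₂ (proj₂ (choose z)) (∈-fiber⁻ f z∈)

  order*b≤k*αₒ : .{{NonZero b}} → order G * b ≤ k * αₒ G
  order*b≤k*αₒ = begin
    order G * b                ≤⟨ *-≤-sum (λ x → ∣ f x ∣) (≤-reflexive ∘ sym ∘ size) ⟩
    sum (λ x → ∣ f x ∣)        ≡⟨ double-count f ⟩
    -- Each color class is a competitor in the maximum defining `αₒ G`.
    sum (λ c → ∣ fiber f c ∣)  ≤⟨ sum-≤-* _ (λ c → proj₂ (proj₂ (maximumIndependentSet G)) _
                                                    (fiber f c , fiber-independent c , refl)) ⟩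
    k * αₒ G                   ∎
    where open ≤-Reasoning

theorem4 : (G : OrientedGraph) → .{{_ : NonZero (order G)}} →
    χₒ* G ≥ʳ fromℚ (+ order G / αₒ G)
-- A rational `q` above the infimum comes with a single `b` whose ratio lies below `q`, so the bound
-- for an optimal `b`-fold coloring suffices and no limit is taken.
theorem4 G q ((b , b≢0) , χ/b<q) = ℚ.≤-<-trans
  (/-mono-≤ (order G) (αₒ G) (χₒ G b) b {{αₒ-nonZero G}} {{b≢0}}
    (order*b≤k*αₒ {G} (proj₂ (proj₁ (proj₂ (minimumFoldColoring G b)))) {{b≢0}}))
  χ/b<q
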